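{- Let $q$ be a prime power, let $n$ and $m\ge3$ be positive integers, and let $I,J$ be nonnegative integers with $I<J<n$. Let $\alpha_1,\dots,\alpha_m\in\mathbb{F}_{q^n}^*$, $\mathbf{A}=(\alpha_1,\dots,\alpha_m)$, and $$U^{I,J}_{\mathbf{A}}:=\{(x_1,\dots,x_m,f_1(\underline{x}),\dots,f_m(\underline{x})) : x_1,\dots,x_m\in\mathbb{F}_{q^n}\}\subseteq\mathbb{F}_{q^n}^{2m},$$ where $f_i(\underline{x})=x_i^{q^I}+\alpha_{i+1}x_{i+1}^{q^J}$ for $i=1,\dots,m-1$ and $f_m(\underline{x})=x_m^{q^I}+\alpha_1x_1^{q^J}$. If $n\ge 2(mJ+J+1)$, then $U^{I,J}_{\mathbf{A}}$ is $(r,\frac{rn}{2}-1)_q$-evasive for every odd $r$ with $2\le r\le m$.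
   Context: For positive integers $h,r$, an $\mathbb{F}_q$-subspace $U\subseteq\mathbb{F}_{q^n}^k$ is $(h,r)_q$-evasive if $\dim_{\mathbb{F}_q}(U\cap H)\le r$ for every $\mathbb{F}_{q^n}$-subspace $H\subseteq\mathbb{F}_{q^n}^k$ with $\dim_{\mathbb{F}_{q^n}}H=h$. -}

module Defs where

open import Level using (0ℓ)
open import Data.Nat as ℕ using (ℕ; zero; suc)
open import Data.Fin using (Fin; zero; suc; toℕ; fromℕ<)
open import Data.List using (List; length)
open import Data.List.Membership.Propositional using (_∈_)
open import Data.List.Relation.Unary.Unique.Propositional using (Unique)
open import Data.Product using (Σ; ∃; _×_; _,_)
open import Relation.Binary.PropositionalEquality using (_≡_; _≢_)
open import Algebra.Structures using (IsCommutativeRing)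
open import Data.Nat.Primality using (Prime)
open import Relation.Nullary using (yes; no)
open import Data.Vec.Functional using (_++_)

IsPrimePower : ℕ → Set
IsPrimePower q = Σ ℕ λ p → Σ ℕ λ e → Prime p × (1 ℕ.≤ e) × (q ≡ p ℕ.^ e)

record FiniteField : Set₁ where
  infixl 6 _+_
  infixl 7 _*_
  field
    Carrier : Set
    _+_ _*_ : Carrier → Carrier → Carrier
    -_      : Carrier → Carrier
    0# 1#   : Carrier
    isCommutativeRing : IsCommutativeRing _≡_ _+_ _*_ -_ 0# 1#
    0≢1     : 0# ≢ 1#
    inverse : ∀ x → x ≢ 0# → Σ Carrier λ y → x * y ≡ 1#
    elems    : List Carrier
    complete : ∀ x → x ∈ elems
    unique   : Unique elems

  card : ℕ
  card = length elems

  _^_ : Carrier → ℕ → Carrier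
  x ^ zero  = 1#
  x ^ suc k = x * (x ^ k)

  Σ[_] : ∀ {s} → (Fin s → Carrier) → Carrier
  Σ[_] {zero}  f = 0#
  Σ[_] {suc s} f = f zero + Σ[_] (λ i → f (suc i))

  Vec : ℕ → Set
  Vec k = Fin k → Carrier

  _≋_ : ∀ {k} → Vec k → Vec k → Set
  u ≋ v = ∀ i → u i ≡ v i

  lincomb : ∀ {k s} → (Fin s → Carrier) → (Fin s → Vec k) → Vec k
  lincomb c v i = Σ[ (λ j → c j * v j i) ]

  InSubfield : ℕ → Carrier → Set
  InSubfield q c = c ^ q ≡ c

  LinIndepOver : ℕ → ∀ {k s} → (Fin s → Vec k) → Set
  LinIndepOver q {k} {s} v =
    (c : Fin s → Carrier) → (∀ j → InSubfield q (c j)) →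
    lincomb c v ≋ (λ _ → 0#) → ∀ j → c j ≡ 0#

  LinIndep : ∀ {k s} → (Fin s → Vec k) → Set
  LinIndep {k} {s} v =
    (c : Fin s → Carrier) → lincomb c v ≋ (λ _ → 0#) → ∀ j → c j ≡ 0#

  InSpan : ∀ {k h} → (Fin h → Vec k) → Vec k → Set
  InSpan {k} {h} b v = Σ (Fin h → Carrier) λ λs → v ≋ lincomb λs b

  -- (h, bound)_q-evasiveness of an F_q-subspace U ⊆ K^k (given as a predicate):
  -- for every K-subspace H = span(b_1..b_h) of K-dimension h (b linearly
  -- independent over K), every F_q-linearly independent family in U ∩ H has
  -- size s satisfying OK s, i.e. dim_{F_q}(U ∩ H) satisfies the bound OK.
  EvasiveWith : ℕ → ∀ {k} → (Vec k → Set) → (h : ℕ) → (ℕ → Set) → Set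
  EvasiveWith q {k} U h OK =
    (b : Fin h → Vec k) → LinIndep b →
    ∀ s (v : Fin s → Vec k) → (∀ j → U (v j)) → (∀ j → InSpan b (v j)) →
    LinIndepOver q v → OK s

  Evasive : ℕ → ∀ {k} → (Vec k → Set) → (h r : ℕ) → Set
  Evasive q U h r = EvasiveWith q U h (λ s → s ℕ.≤ r)

next : ∀ {m} → Fin m → Fin m
next {suc m} i with toℕ i ℕ.<? m
... | yes p = suc (fromℕ< p)
... | no _ = zero

Odd : ℕ → Set
Odd r = Σ ℕ λ k → r ≡ suc (2 ℕ.* k)

module _ (F : FiniteField) where
  open FiniteField F

  fA : (q I J : ℕ) → ∀ {m} → (Fin m → Carrier) → Vec m → Vec m
  fA q I J α x i = (x i ^ (q ℕ.^ I)) + (α (next i) * (x (next i) ^ (q ℕ.^ J)))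

  U-IJ : (q I J : ℕ) → ∀ {m} → (Fin m → Carrier) → Vec (m ℕ.+ m) → Set
  U-IJ q I J {m} α v = Σ (Vec m) λ x → v ≋ (x ++ fA q I J α x)

{-# OPTIONS --safe #-}

-- Let x^(1), …, x^(s) be an F_q-basis of U ∩ H (projected to the first m coordinates) and put
-- y_(i,d) = ((x_i^(j))^(q^d))_j ∈ K^s and T_d = span_K { y_(i,e) : e ≤ d }.  By Dedekind's argument
-- T_(n-1) = K^s, so it suffices to bound the increments δ_d = dim T_d − dim T_(d-1).
-- Since T_(d+1) is generated by T_d and its Frobenius twist, a set A of indices for which
-- (y_(i,J))_(i∈A) is a basis of T_J modulo T_(J-1) also spans every later increment, whence
-- s ≤ mJ + n|A|.  On the other hand the vectors y_(i,0) and (f_(i-1)(x^(j)))_j with i ∈ A are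
-- independent: modulo T_(J-1) the latter are α_i y_(i,J), because I < J, and a relation among
-- the former twists to one among the y_(i,J).  All of them lie in the span of the r coordinate
-- vectors with respect to a basis of H, so 2|A| ≤ r, and |A| ≤ (r−1)/2 because r is odd.
-- Formally, the subspaces T_d enter only through their annihilators in K^s.

module Submission where

open import Defs
open import Level using (0ℓ)
open import Data.Nat as ℕ using (ℕ; zero; suc; z≤n; s≤s; _!)
import Data.Nat.Properties as ℕ
open import Data.Nat.Combinatorics using (_C_; nCn≡1; k![n∸k]!∣n!)
open import Data.Nat.Combinatorics.Specification using (nCk≡n!/k![n-k]!)
open import Data.Nat.Divisibility using (_∣_; divides; ∣⇒≤; m∣m*n)
open import Data.Nat.DivMod using (m/n*n≡m)
open import Data.Nat.Primality using (Prime; euclidsLemma; prime⇒nonZero; prime⇒nonTrivial)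
open import Data.Nat.Solver using (module +-*-Solver)
open import Data.Fin using (Fin; zero; suc; toℕ; fromℕ; inject₁; fromℕ<; _↑ˡ_; _↑ʳ_; splitAt; join; combine; remQuot; finToFun; funToFin)
import Data.Fin.Properties as Fin
open import Data.List using (List; []; _∷_; length; lookup; map; foldr; filter)
open import Data.List.Membership.Propositional using (_∈_)
open import Data.List.Membership.Propositional.Properties using (∈-map⁺; ∈-map⁻; ∈-filter⁺; ∈-filter⁻; ∈-lookup)
open import Data.List.Membership.Propositional.Properties.WithK using (unique∧set⇒bag)
open import Data.List.Relation.Binary.BagAndSetEquality using (∼bag⇒↭)
open import Data.List.Relation.Binary.Permutation.Propositional using (_↭_; ↭⇒↭ₛ)
open import Data.List.Relation.Binary.Permutation.Propositional.Properties using (↭-length)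
open import Data.List.Relation.Binary.Permutation.Setoid.Properties using (foldr-commMonoid)
open import Data.List.Relation.Unary.All as All using (All)
open import Data.List.Relation.Unary.AllPairs using (_∷_)
open import Data.List.Relation.Unary.Any using (here; there; index)
open import Data.List.Relation.Unary.Any.Properties using (lookup-index)
open import Data.List.Relation.Unary.Unique.Propositional using (Unique)
open import Data.List.Relation.Unary.Unique.Propositional.Properties using (map⁺; filter⁺)
open import Data.Product using (Σ; ∃; _×_; _,_; proj₁; proj₂)
open import Data.Sum using (_⊎_; inj₁; inj₂; [_,_])
open import Data.Vec.Functional using (_++_)
open import Function using (_∘_; mk⇔)
open import Relation.Nullary using (¬_; Dec; yes; no; contradiction; ¬?)
open import Relation.Nullary.Decidable using (_×-dec_; map′; decidable-stable)
open import Relation.Binary.PropositionalEquality using (_≡_; _≢_; refl; sym; trans; cong; cong₂; subst; setoid; module ≡-Reasoning)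
open import Algebra.Bundles using (CommutativeRing; CommutativeMonoid)
import Algebra.Properties.CommutativeSemigroup
import Algebra.Properties.CommutativeSemiring.Binomial
import Algebra.Properties.CommutativeSemiring.Exp
import Algebra.Properties.Group
import Algebra.Properties.Monoid.Mult
import Algebra.Properties.Ring
import Algebra.Properties.Semiring.Mult
import Algebra.Properties.Semiring.Sum

-- Binomial coefficients modulo a prime.

prime∤! : ∀ {p} → Prime p → ∀ k → k ℕ.< p → ¬ (p ∣ k !)
prime∤! pp zero    _   p∣1 = ℕ.<⇒≱ (ℕ.nonTrivial⇒n>1 _ {{prime⇒nonTrivial pp}}) (∣⇒≤ p∣1)
prime∤! pp (suc k) k<p p∣k! with euclidsLemma (suc k) (k !) pp p∣k!
... | inj₁ p∣1+k = ℕ.<⇒≱ k<p (∣⇒≤ p∣1+k)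
... | inj₂ p∣k!  = prime∤! pp k (ℕ.<-trans (ℕ.n<1+n k) k<p) p∣k!

-- Multiplying by k! (p - k)! gives p!, and p divides neither factorial because all their factors
-- are smaller than p.
prime∣binomial : ∀ {p k} → Prime p → 0 ℕ.< k → k ℕ.< p → p ∣ p C k
prime∣binomial {p@(suc p-1)} {k} pp 0<k k<p
  with euclidsLemma (p C k) (k ! ℕ.* (p ℕ.∸ k) !) pp p∣C*k!*[p-k]!
  where
  k≤p = ℕ.<⇒≤ k<p
  p∣C*k!*[p-k]! : p ∣ (p C k) ℕ.* (k ! ℕ.* (p ℕ.∸ k) !)
  p∣C*k!*[p-k]! = subst (p ∣_)
    (sym (trans (cong (ℕ._* (k ! ℕ.* (p ℕ.∸ k) !)) (nCk≡n!/k![n-k]! k≤p))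
                (m/n*n≡m {{ℕ._!*_!≢0 k (p ℕ.∸ k)}} (k![n∸k]!∣n! k≤p))))
    (m∣m*n (p-1 !))
... | inj₁ p∣C = p∣C
... | inj₂ p∣k!*[p-k]! with euclidsLemma (k !) ((p ℕ.∸ k) !) pp p∣k!*[p-k]!
...   | inj₁ p∣k!     = contradiction p∣k! (prime∤! pp k k<p)
...   | inj₂ p∣[p-k]! = contradiction p∣[p-k]! (prime∤! pp (p ℕ.∸ k) (ℕ.∸-monoʳ-< 0<k (ℕ.<⇒≤ k<p)))

-- Lists, finite types and the cyclic successor.

Unique⇒lookup-injective : ∀ {A : Set} {xs : List A} → Unique xs →
                          ∀ i j → lookup xs i ≡ lookup xs j → i ≡ j
Unique⇒lookup-injective (_ ∷ _) zero zero _ = refl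
Unique⇒lookup-injective (x∉xs ∷ _) zero (suc j) eq = contradiction eq (All.lookup x∉xs (∈-lookup j))
Unique⇒lookup-injective (x∉xs ∷ _) (suc i) zero eq = contradiction (sym eq) (All.lookup x∉xs (∈-lookup i))
Unique⇒lookup-injective (_ ∷ u) (suc i) (suc j) eq = cong suc (Unique⇒lookup-injective u i j eq)

unique∧sameElements⇒↭ : ∀ {A : Set} {xs ys : List A} → Unique xs → Unique ys →
  (∀ {x} → x ∈ xs → x ∈ ys) → (∀ {x} → x ∈ ys → x ∈ xs) → xs ↭ ys
unique∧sameElements⇒↭ u v xs⊆ys ys⊆xs = ∼bag⇒↭ (unique∧set⇒bag u v (mk⇔ xs⊆ys ys⊆xs))

funToFin-cong : ∀ {m n} {f g : Fin m → Fin n} → (∀ i → f i ≡ g i) → funToFin f ≡ funToFin g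
funToFin-cong {zero}  f≗g = refl
funToFin-cong {suc m} f≗g = cong₂ combine (f≗g zero) (funToFin-cong (f≗g ∘ suc))

distinct⇒1<size : ∀ {n} (i j : Fin n) → i ≢ j → 1 ℕ.< n
distinct⇒1<size {suc zero}    zero zero i≢j = contradiction refl i≢j
distinct⇒1<size {suc (suc n)} _    _    _   = s≤s (s≤s z≤n)

-- Ensures that every coordinate occurs in the q^J-term of some f_k; coordinate `zero` does so by
-- the wrap-around at the last index.
next-surjective : ∀ {m} (i : Fin m) → ∃ λ k → next k ≡ i
next-surjective {suc m} zero = fromℕ m , last-wraps
  where
  last-wraps : next (fromℕ m) ≡ zero
  last-wraps with toℕ (fromℕ m) ℕ.<? m
  ... | yes m<m = contradiction (subst (ℕ._< m) (Fin.toℕ-fromℕ m) m<m) (ℕ.<-irrefl refl)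
  ... | no _    = refl
next-surjective {suc m} (suc i) = inject₁ i , step
  where
  step : next (inject₁ i) ≡ suc i
  step with toℕ (inject₁ i) ℕ.<? m
  ... | yes p = cong suc (Fin.toℕ-injective (trans (Fin.toℕ-fromℕ< p) (Fin.toℕ-inject₁ i)))
  ... | no ¬p = contradiction (subst (ℕ._< m) (sym (Fin.toℕ-inject₁ i)) (Fin.toℕ<n i)) ¬p

-- Arithmetic of finite fields and Lagrange's identities.

module _ (M : CommutativeMonoid 0ℓ 0ℓ) where
  open CommutativeMonoid M hiding (refl; sym; trans)
  open Algebra.Properties.Monoid.Mult monoid using () renaming (_×_ to _·_)
  open Algebra.Properties.CommutativeSemigroup commutativeSemigroup using (interchange)

  -- The computation behind Lagrange's argument, shared by addition and multiplication: if
  -- translation by `x` permutes `ys`, cancelling the common total leaves `length ys · x` trivial.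
  foldr-map-∙ : ∀ x ys → foldr _∙_ ε (map (x ∙_) ys) ≈ (length ys · x) ∙ foldr _∙_ ε ys
  foldr-map-∙ x []       = CommutativeMonoid.sym M (identityˡ ε)
  foldr-map-∙ x (y ∷ ys) = CommutativeMonoid.trans M (∙-congˡ (foldr-map-∙ x ys)) (interchange x y _ _)

module FiniteFieldProperties (F : FiniteField) where
  open FiniteField F
  open ≡-Reasoning

  commutativeRing : CommutativeRing 0ℓ 0ℓ
  commutativeRing = record { isCommutativeRing = isCommutativeRing }

  open CommutativeRing commutativeRing
    using (ring; semiring; commutativeSemiring; +-group; +-commutativeMonoid; *-commutativeMonoid;
           +-isCommutativeMonoid; *-isCommutativeMonoid; +-identityˡ; +-identityʳ;
           *-identityˡ; *-identityʳ; *-assoc; *-comm; distribˡ; distribʳ; zeroˡ; zeroʳ; -‿inverseʳ)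
  open Algebra.Properties.Group +-group using (x∙y⁻¹≈ε⇒x≈y) renaming (identityˡ-unique to +-identityˡ-unique)
  open Algebra.Properties.CommutativeSemigroup (CommutativeRing.*-commutativeSemigroup commutativeRing)
    using (x∙yz≈y∙xz)
  open Algebra.Properties.Semiring.Mult semiring using (×1-homo-*; ×-assocˡ; ×-assoc-*; ×-congʳ; ×-homo-1)
    renaming (_×_ to _·_)
  private
    module Exp = Algebra.Properties.CommutativeSemiring.Exp commutativeSemiring
    module Sum = Algebra.Properties.Semiring.Sum semiring
    module Binomial = Algebra.Properties.CommutativeSemiring.Binomial commutativeSemiring

  code : Carrier → Fin card
  code x = index (complete x)

  decode : Fin card → Carrier
  decode = lookup elems

  decode-code : ∀ x → decode (code x) ≡ x
  decode-code x = sym (lookup-index (complete x))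

  code-injective : ∀ {x y} → code x ≡ code y → x ≡ y
  code-injective {x} {y} eq = trans (sym (decode-code x)) (trans (cong decode eq) (decode-code y))

  _≟_ : (x y : Carrier) → Dec (x ≡ y)
  x ≟ y = map′ code-injective (cong code) (code x Fin.≟ code y)

  1<card : 1 ℕ.< card
  1<card = distinct⇒1<size (code 0#) (code 1#) (λ eq → 0≢1 (code-injective eq))

  *-cancelˡ-nonZero : ∀ {x y z} → x ≢ 0# → x * y ≡ x * z → y ≡ z
  *-cancelˡ-nonZero {x} {y} {z} x≢0 eq with inverse x x≢0
  ... | x⁻¹ , xx⁻¹≡1 = trans (sym (undo y)) (trans (cong (x⁻¹ *_) eq) (undo z))
    where
    undo : ∀ t → x⁻¹ * (x * t) ≡ t
    undo t = begin
      x⁻¹ * (x * t)  ≡⟨ *-assoc x⁻¹ x t ⟨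
      (x⁻¹ * x) * t  ≡⟨ cong (_* t) (trans (*-comm x⁻¹ x) xx⁻¹≡1) ⟩
      1# * t         ≡⟨ *-identityˡ t ⟩
      t              ∎

  x*y≡0⇒y≡0 : ∀ {x y} → x ≢ 0# → x * y ≡ 0# → y ≡ 0#
  x*y≡0⇒y≡0 {x} x≢0 eq = *-cancelˡ-nonZero x≢0 (trans eq (sym (zeroʳ x)))

  *-nonZero : ∀ {x y} → x ≢ 0# → y ≢ 0# → x * y ≢ 0#
  *-nonZero x≢0 y≢0 eq = y≢0 (x*y≡0⇒y≡0 x≢0 eq)

  x^k≡0⇒x≡0 : ∀ x k → x ^ k ≡ 0# → x ≡ 0#
  x^k≡0⇒x≡0 x zero    eq = contradiction (sym eq) 0≢1
  x^k≡0⇒x≡0 x (suc k) eq with x ≟ 0#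
  ... | yes x≡0 = x≡0
  ... | no  x≢0 = x^k≡0⇒x≡0 x k (x*y≡0⇒y≡0 x≢0 eq)

  ^≡Exp : ∀ x k → x ^ k ≡ x Exp.^ k
  ^≡Exp x zero    = refl
  ^≡Exp x (suc k) = cong (x *_) (^≡Exp x k)

  ^-*-assoc : ∀ x j k → (x ^ j) ^ k ≡ x ^ (j ℕ.* k)
  ^-*-assoc x j k = begin
    (x ^ j) ^ k          ≡⟨ cong (_^ k) (^≡Exp x j) ⟩
    (x Exp.^ j) ^ k      ≡⟨ ^≡Exp _ k ⟩
    (x Exp.^ j) Exp.^ k  ≡⟨ Exp.^-assocʳ x j k ⟩
    x Exp.^ (j ℕ.* k)    ≡⟨ ^≡Exp x (j ℕ.* k) ⟨
    x ^ (j ℕ.* k)        ∎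

  ^-distrib-* : ∀ x y k → (x * y) ^ k ≡ x ^ k * y ^ k
  ^-distrib-* x y k = begin
    (x * y) ^ k              ≡⟨ ^≡Exp (x * y) k ⟩
    (x * y) Exp.^ k          ≡⟨ Exp.^-distrib-* x y k ⟩
    x Exp.^ k * y Exp.^ k    ≡⟨ cong₂ _*_ (^≡Exp x k) (^≡Exp y k) ⟨
    x ^ k * y ^ k            ∎

  0^k≡0 : ∀ {k} → 0 ℕ.< k → 0# ^ k ≡ 0#
  0^k≡0 (s≤s _) = zeroˡ _

  card·x≡0 : ∀ x → card · x ≡ 0#
  card·x≡0 x = +-identityˡ-unique (card · x) (foldr _+_ 0# elems) (begin
    card · x + foldr _+_ 0# elems       ≡⟨ foldr-map-∙ +-commutativeMonoid x elems ⟨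
    foldr _+_ 0# (map (x +_) elems)
      ≡⟨ foldr-commMonoid (setoid Carrier) +-isCommutativeMonoid (↭⇒↭ₛ translate) ⟩
    foldr _+_ 0# elems                  ∎)
    where
    open Algebra.Properties.Group +-group using (∙-cancelˡ; \\-leftDividesˡ)
    translate : map (x +_) elems ↭ elems
    translate = unique∧sameElements⇒↭ (map⁺ (∙-cancelˡ x _ _) unique) unique (λ _ → complete _)
      (λ {y} _ → subst (_∈ map (x +_) elems) (\\-leftDividesˡ x y) (∈-map⁺ (x +_) (complete _)))

  -- For nonzero `x`, multiplication by `x` permutes the units, and cancelling their product leaves
  -- a power of `x` equal to 1. Zero contributes the one further factor `x`.
  x^card≡x : ∀ x → x ^ card ≡ x
  x^card≡x x with x ≟ 0#
  ... | yes refl = 0^k≡0 (ℕ.<-trans (s≤s z≤n) 1<card)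
  ... | no x≢0 = begin
    x ^ card                    ≡⟨ cong (x ^_) (↭-length split) ⟩
    x * (x ^ length units)      ≡⟨ cong (x *_) x^|units|≡1 ⟩
    x * 1#                      ≡⟨ *-identityʳ x ⟩
    x                           ∎
    where
    nonZero? : ∀ y → Dec (y ≢ 0#)
    nonZero? y = ¬? (y ≟ 0#)
    units : List Carrier
    units = filter nonZero? elems
    ∈-units : ∀ {y} → y ≢ 0# → y ∈ units
    ∈-units y≢0 = ∈-filter⁺ nonZero? (complete _) y≢0
    units-nonZero : ∀ {y} → y ∈ units → y ≢ 0#
    units-nonZero y∈ = proj₂ (∈-filter⁻ nonZero? {xs = elems} y∈)
    units-unique : Unique units
    units-unique = filter⁺ nonZero? unique
    in-0∷units : ∀ y → y ∈ 0# ∷ units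
    in-0∷units y with y ≟ 0#
    ... | yes y≡0 = here y≡0
    ... | no  y≢0 = there (∈-units y≢0)
    split : elems ↭ 0# ∷ units
    split = unique∧sameElements⇒↭ unique
      (All.tabulate (λ y∈ 0≡y → units-nonZero y∈ (sym 0≡y)) ∷ units-unique)
      (λ _ → in-0∷units _) (λ _ → complete _)
    x*units : map (x *_) units ↭ units
    x*units = unique∧sameElements⇒↭ (map⁺ (*-cancelˡ-nonZero x≢0) units-unique) units-unique fwd bwd
      where
      fwd : ∀ {y} → y ∈ map (x *_) units → y ∈ units
      fwd y∈ with ∈-map⁻ (x *_) y∈
      ... | z , z∈ , refl = ∈-units (*-nonZero x≢0 (units-nonZero z∈))
      bwd : ∀ {y} → y ∈ units → y ∈ map (x *_) units
      bwd {y} y∈ with inverse x x≢0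
      ... | x⁻¹ , xx⁻¹≡1 = subst (_∈ map (x *_) units) xz≡y (∈-map⁺ (x *_) (∈-units z≢0))
        where
        xz≡y : x * (x⁻¹ * y) ≡ y
        xz≡y = trans (sym (*-assoc x x⁻¹ y)) (trans (cong (_* y) xx⁻¹≡1) (*-identityˡ y))
        z≢0 : x⁻¹ * y ≢ 0#
        z≢0 z≡0 = units-nonZero y∈ (trans (sym xz≡y) (trans (cong (x *_) z≡0) (zeroʳ x)))
    Π : List Carrier → Carrier
    Π = foldr _*_ 1#
    Π-nonZero : ∀ ys → All (_≢ 0#) ys → Π ys ≢ 0#
    Π-nonZero []       All.[]         eq = 0≢1 (sym eq)
    Π-nonZero (y ∷ ys) (y≢0 All.∷ ne) = *-nonZero y≢0 (Π-nonZero ys ne)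
    x^|units|≡1 : x ^ length units ≡ 1#
    x^|units|≡1 = *-cancelˡ-nonZero (Π-nonZero units (All.tabulate units-nonZero)) (begin
      Π units * x ^ length units       ≡⟨ *-comm _ _ ⟩
      x ^ length units * Π units       ≡⟨ cong (_* Π units) (^≡Exp x (length units)) ⟩
      x Exp.^ length units * Π units   ≡⟨ foldr-map-∙ *-commutativeMonoid x units ⟨
      Π (map (x *_) units)             ≡⟨ foldr-commMonoid (setoid Carrier) *-isCommutativeMonoid (↭⇒↭ₛ x*units) ⟩
      Π units                          ≡⟨ *-identityʳ _ ⟨
      Π units * 1#                     ∎)

  -- Finite sums and the bilinear pairing.

  Σ≡sum : ∀ {s} (f : Vec s) → Σ[ f ] ≡ Sum.sum f
  Σ≡sum {zero}  f = refl
  Σ≡sum {suc s} f = cong (f zero +_) (Σ≡sum (f ∘ suc))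

  Σ-cong : ∀ {s} {f g : Vec s} → f ≋ g → Σ[ f ] ≡ Σ[ g ]
  Σ-cong {zero}  f≋g = refl
  Σ-cong {suc s} f≋g = cong₂ _+_ (f≋g zero) (Σ-cong (f≋g ∘ suc))

  Σ-zero : ∀ {s} {f : Vec s} → (∀ i → f i ≡ 0#) → Σ[ f ] ≡ 0#
  Σ-zero {zero}  f≋0 = refl
  Σ-zero {suc s} f≋0 = trans (cong₂ _+_ (f≋0 zero) (Σ-zero (f≋0 ∘ suc))) (+-identityˡ 0#)

  Σ-+ : ∀ {s} (f g : Vec s) → Σ[ (λ i → f i + g i) ] ≡ Σ[ f ] + Σ[ g ]
  Σ-+ f g = trans (Σ≡sum (λ i → f i + g i)) (trans (Sum.∑-distrib-+ f g) (sym (cong₂ _+_ (Σ≡sum f) (Σ≡sum g))))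

  *-Σ : ∀ {s} x (f : Vec s) → x * Σ[ f ] ≡ Σ[ (λ i → x * f i) ]
  *-Σ x f = trans (cong (x *_) (Σ≡sum f)) (trans (Sum.*-distribˡ-sum x f) (sym (Σ≡sum (λ i → x * f i))))

  Σ-comm : ∀ {s t} (f : Fin s → Fin t → Carrier) →
           Σ[ (λ i → Σ[ f i ]) ] ≡ Σ[ (λ j → Σ[ (λ i → f i j) ]) ]
  Σ-comm f = trans (Σ²≡sum² f) (trans (Sum.∑-comm f) (sym (Σ²≡sum² (λ j i → f i j))))
    where
    Σ²≡sum² : ∀ {s t} (g : Fin s → Fin t → Carrier) → Σ[ (λ i → Σ[ g i ]) ] ≡ Sum.sum (λ i → Sum.sum (g i))
    Σ²≡sum² g = trans (Σ-cong (λ i → Σ≡sum (g i))) (Σ≡sum (λ i → Sum.sum (g i)))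

  Σ-↑ : ∀ s t (f : Vec (s ℕ.+ t)) → Σ[ f ] ≡ Σ[ (λ i → f (i ↑ˡ t)) ] + Σ[ (λ i → f (s ↑ʳ i)) ]
  Σ-↑ zero    t f = sym (+-identityˡ _)
  Σ-↑ (suc s) t f = trans (cong (f zero +_) (Σ-↑ s t (f ∘ suc))) (sym (CommutativeRing.+-assoc commutativeRing _ _ _))

  ⟨_,_⟩ : ∀ {s} → Vec s → Vec s → Carrier
  ⟨ u , v ⟩ = Σ[ (λ j → u j * v j) ]

  ⟨⟩-cong : ∀ {s} {u u′ v v′ : Vec s} → u ≋ u′ → v ≋ v′ → ⟨ u , v ⟩ ≡ ⟨ u′ , v′ ⟩
  ⟨⟩-cong u≋u′ v≋v′ = Σ-cong (λ j → cong₂ _*_ (u≋u′ j) (v≋v′ j))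

  ⟨⟩-zeroʳ : ∀ {s} (u : Vec s) {v} → (∀ j → v j ≡ 0#) → ⟨ u , v ⟩ ≡ 0#
  ⟨⟩-zeroʳ u v≋0 = Σ-zero (λ j → trans (cong (u j *_) (v≋0 j)) (zeroʳ (u j)))

  ⟨⟩-+ʳ : ∀ {s} (u v w : Vec s) → ⟨ u , (λ j → v j + w j) ⟩ ≡ ⟨ u , v ⟩ + ⟨ u , w ⟩
  ⟨⟩-+ʳ u v w = trans (Σ-cong (λ j → distribˡ (u j) (v j) (w j))) (Σ-+ (λ j → u j * v j) (λ j → u j * w j))

  ⟨⟩-*ʳ : ∀ {s} x (u v : Vec s) → ⟨ u , (λ j → x * v j) ⟩ ≡ x * ⟨ u , v ⟩
  ⟨⟩-*ʳ x u v = trans (Σ-cong (λ j → x∙yz≈y∙xz (u j) x (v j))) (sym (*-Σ x (λ j → u j * v j)))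

  ⟨⟩-*ˡ : ∀ {s} x (u v : Vec s) → ⟨ (λ j → x * u j) , v ⟩ ≡ x * ⟨ u , v ⟩
  ⟨⟩-*ˡ x u v = trans (Σ-cong (λ j → *-assoc x (u j) (v j))) (sym (*-Σ x (λ j → u j * v j)))

  ⟨⟩--ˡ : ∀ {s} (u v w : Vec s) → ⟨ (λ j → u j + - v j) , w ⟩ ≡ ⟨ u , w ⟩ + - ⟨ v , w ⟩
  ⟨⟩--ˡ u v w = begin
    ⟨ (λ j → u j + - v j) , w ⟩             ≡⟨ Σ-cong (λ j → distribʳ (w j) (u j) (- v j)) ⟩
    Σ[ (λ j → u j * w j + - v j * w j) ]    ≡⟨ Σ-+ (λ j → u j * w j) (λ j → - v j * w j) ⟩
    ⟨ u , w ⟩ + ⟨ (λ j → - v j) , w ⟩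
      ≡⟨ cong (⟨ u , w ⟩ +_) (trans (⟨⟩-cong (λ j → sym (-1*x≈-x (v j))) (λ _ → refl)) (⟨⟩-*ˡ (- 1#) v w)) ⟩
    ⟨ u , w ⟩ + - 1# * ⟨ v , w ⟩            ≡⟨ cong (⟨ u , w ⟩ +_) (-1*x≈-x ⟨ v , w ⟩) ⟩
    ⟨ u , w ⟩ + - ⟨ v , w ⟩                 ∎
    where open Algebra.Properties.Ring ring using (-1*x≈-x)

  ⟨⟩-swap : ∀ {s t} (c : Vec t) (w : Vec s) (z : Fin t → Vec s) →
            ⟨ c , (λ p → ⟨ w , z p ⟩) ⟩ ≡ ⟨ w , (λ j → ⟨ c , (λ p → z p j) ⟩) ⟩
  ⟨⟩-swap c w z = begin
    ⟨ c , (λ p → ⟨ w , z p ⟩) ⟩                        ≡⟨ Σ-cong (λ p → *-Σ (c p) (λ j → w j * z p j)) ⟩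
    Σ[ (λ p → Σ[ (λ j → c p * (w j * z p j)) ]) ]      ≡⟨ Σ-comm (λ p j → c p * (w j * z p j)) ⟩
    Σ[ (λ j → Σ[ (λ p → c p * (w j * z p j)) ]) ]      ≡⟨ Σ-cong (λ j → ⟨⟩-*ʳ (w j) c (λ p → z p j)) ⟩
    ⟨ w , (λ j → ⟨ c , (λ p → z p j) ⟩) ⟩              ∎

  -- Linear algebra over a finite field by counting and search.

  vec : ∀ {s} → Fin (card ℕ.^ s) → Vec s
  vec z j = decode (finToFun z j)

  unvec : ∀ {s} → Vec s → Fin (card ℕ.^ s)
  unvec u = funToFin (code ∘ u)

  vec-unvec : ∀ {s} (u : Vec s) → vec (unvec u) ≋ u
  vec-unvec u j = trans (cong decode (Fin.finToFun-funToFin (code ∘ u) j)) (decode-code (u j))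

  vec-injective : ∀ {s} {y z : Fin (card ℕ.^ s)} → vec {s} y ≋ vec z → y ≡ z
  vec-injective {s} {y} {z} eq = trans (sym (Fin.funToFin-finToFin {s} y))
    (trans (funToFin-cong (λ j → Unique⇒lookup-injective unique _ _ (eq j))) (Fin.funToFin-finToFin {s} z))

  -- Counting replaces elimination: `card ^ s` vectors have at most `card ^ t` tuples of values on
  -- `g`, so two distinct vectors share a tuple, and their difference is `c`.
  nontrivialKernel : ∀ {t s} → t ℕ.< s → (g : Fin t → Vec s) →
    ∃ λ (c : Vec s) → ¬ (∀ j → c j ≡ 0#) × (∀ l → ⟨ c , g l ⟩ ≡ 0#)
  nontrivialKernel {t} {s} t<s g
    with Fin.pigeonhole (ℕ.^-monoʳ-< card 1<card t<s) (λ z → unvec (λ l → ⟨ vec {s} z , g l ⟩))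
  ... | y , z , y<z , eq = c , c≢0 , c⊥g
    where
    c : Vec s
    c j = vec {s} y j + - vec {s} z j
    c≢0 : ¬ (∀ j → c j ≡ 0#)
    c≢0 c≡0 = Fin.<⇒≢ y<z (vec-injective {s} (λ j → x∙y⁻¹≈ε⇒x≈y _ _ (c≡0 j)))
    values : ∀ l → ⟨ vec {s} y , g l ⟩ ≡ ⟨ vec {s} z , g l ⟩
    values l = trans (sym (vec-unvec (λ l → ⟨ vec {s} y , g l ⟩) l))
      (trans (cong (λ i → vec {t} i l) eq) (vec-unvec (λ l → ⟨ vec {s} z , g l ⟩) l))
    c⊥g : ∀ l → ⟨ c , g l ⟩ ≡ 0#
    c⊥g l = trans (⟨⟩--ˡ (vec {s} y) (vec {s} z) (g l))
      (trans (cong (_+ - ⟨ vec {s} z , g l ⟩) (values l)) (-‿inverseʳ _))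

  -- Invariance under `≋` is asked for because decoding recovers a vector only pointwise.
  searchVec : ∀ {s} {P : Vec s → Set} → (∀ {u v} → u ≋ v → P u → P v) → (∀ u → Dec (P u)) → Dec (∃ P)
  searchVec {s} P-resp P? = map′ (λ (z , Pz) → vec {s} z , Pz)
    (λ (u , Pu) → unvec u , P-resp (λ j → sym (vec-unvec u j)) Pu)
    (Fin.any? (λ z → P? (vec {s} z)))

  -- Greedy choice of a basis among the functionals `ℓ i` on `W`: one that vanishes on `W` is
  -- skipped, any other is kept and `W` is cut down to its zero set. The conclusions are
  -- independence and spanning, both expressed by values on `W`.
  selectBasis : ∀ {s m} {W : Vec s → Set} → (∀ {u v} → u ≋ v → W u → W v) → (∀ u → Dec (W u)) →
    (ℓ : Fin m → Vec s → Carrier) → (∀ i {u v} → u ≋ v → ℓ i u ≡ ℓ i v) →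
    ∃ λ a → Σ (Fin a → Fin m) λ A →
      (∀ (c : Vec a) → (∀ w → W w → ⟨ c , (λ p → ℓ (A p) w) ⟩ ≡ 0#) → ∀ p → c p ≡ 0#) ×
      (∀ w → W w → (∀ p → ℓ (A p) w ≡ 0#) → ∀ i → ℓ i w ≡ 0#)
  selectBasis {m = zero} _ _ _ _ = 0 , (λ ()) , (λ _ _ ()) , (λ _ _ _ ())
  selectBasis {m = suc m} {W} W-resp W? ℓ ℓ-resp
    with searchVec {P = λ w → W w × ℓ zero w ≢ 0#}
           (λ u≋v (Wu , ne) → W-resp u≋v Wu , λ eq → ne (trans (ℓ-resp zero u≋v) eq))
           (λ w → W? w ×-dec ¬? (ℓ zero w ≟ 0#))
  ... | no vanishes with selectBasis W-resp W? (ℓ ∘ suc) (ℓ-resp ∘ suc)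
  ...   | a , A , indep , span = a , suc ∘ A , indep , λ where
            w Ww _  zero    → decidable-stable (ℓ zero w ≟ 0#) (λ ne → vanishes (w , Ww , ne))
            w Ww ⊥A (suc i) → span w Ww ⊥A i
  selectBasis {m = suc m} {W} W-resp W? ℓ ℓ-resp
      | yes (w₀ , Ww₀ , ℓw₀≢0)
    with selectBasis {W = λ w → W w × ℓ zero w ≡ 0#}
           (λ u≋v (Wu , eq) → W-resp u≋v Wu , trans (sym (ℓ-resp zero u≋v)) eq)
           (λ w → W? w ×-dec (ℓ zero w ≟ 0#)) (ℓ ∘ suc) (ℓ-resp ∘ suc)
  ...   | a , A , indep , span = suc a , A⁺ , indep⁺ , span⁺
    where
    A⁺ : Fin (suc a) → Fin (suc m)
    A⁺ zero    = zero
    A⁺ (suc p) = suc (A p)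
    indep⁺ : ∀ (c : Vec (suc a)) → (∀ w → W w → ⟨ c , (λ p → ℓ (A⁺ p) w) ⟩ ≡ 0#) → ∀ p → c p ≡ 0#
    indep⁺ c vanish = λ where
        -- With the later coefficients zero, evaluation at `w₀` isolates `c zero`.
        zero    → x*y≡0⇒y≡0 ℓw₀≢0 (begin
          ℓ zero w₀ * c zero                                     ≡⟨ *-comm _ _ ⟩
          c zero * ℓ zero w₀                                     ≡⟨ +-identityʳ _ ⟨
          c zero * ℓ zero w₀ + 0#
            ≡⟨ cong (c zero * ℓ zero w₀ +_) (Σ-zero (λ p → trans (cong (_* ℓ (suc (A p)) w₀) (c′≡0 p)) (zeroˡ _))) ⟨
          ⟨ c , (λ p → ℓ (A⁺ p) w₀) ⟩                            ≡⟨ vanish w₀ Ww₀ ⟩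
          0#                                                     ∎)
        (suc p) → c′≡0 p
      where
      c′≡0 : ∀ p → c (suc p) ≡ 0#
      -- On the zero set of `ℓ zero` the first term drops out, so the inductive independence
      -- applies.
      c′≡0 = indep (c ∘ suc) λ w (Ww , ℓ₀w≡0) → begin
        ⟨ c ∘ suc , (λ p → ℓ (suc (A p)) w) ⟩                            ≡⟨ +-identityˡ _ ⟨
        0# + ⟨ c ∘ suc , (λ p → ℓ (suc (A p)) w) ⟩
          ≡⟨ cong (_+ ⟨ c ∘ suc , (λ p → ℓ (suc (A p)) w) ⟩) (trans (cong (c zero *_) ℓ₀w≡0) (zeroʳ _)) ⟨
        ⟨ c , (λ p → ℓ (A⁺ p) w) ⟩                                       ≡⟨ vanish w Ww ⟩
        0#                                                               ∎
    span⁺ : ∀ w → W w → (∀ p → ℓ (A⁺ p) w ≡ 0#) → ∀ i → ℓ i w ≡ 0#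
    span⁺ w Ww ⊥A zero    = ⊥A zero
    span⁺ w Ww ⊥A (suc i) = span w (Ww , ⊥A zero) (⊥A ∘ suc) i

  -- Additivity of the Frobenius map.

  freshman : ∀ {p} → Prime p → p · 1# ≡ 0# → ∀ x y → (x + y) ^ p ≡ x ^ p + y ^ p
  freshman {zero}  pp _ = contradiction refl (ℕ.≢-nonZero⁻¹ 0 {{prime⇒nonZero pp}})
  freshman {p@(suc p-1)} pp p·1≡0 x y = begin
    (x + y) ^ p                                       ≡⟨ ^≡Exp (x + y) p ⟩
    (x + y) Exp.^ p                                   ≡⟨ Binomial.theorem p x y ⟩
    t zero + Sum.sum (t ∘ suc)                        ≡⟨ cong₂ _+_ first (Sum.sum-init-last (t ∘ suc)) ⟩
    y ^ p + (Sum.sum (t ∘ suc ∘ inject₁) + t (fromℕ p))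
      ≡⟨ cong (y ^ p +_) (cong₂ _+_ (trans (sym (Σ≡sum (t ∘ suc ∘ inject₁))) (Σ-zero middle)) last) ⟩
    y ^ p + (0# + x ^ p)                              ≡⟨ cong (y ^ p +_) (+-identityˡ _) ⟩
    y ^ p + x ^ p                                     ≡⟨ CommutativeRing.+-comm commutativeRing _ _ ⟩
    x ^ p + y ^ p                                     ∎
    where
    t : Fin (suc p) → Carrier
    t = Binomial.binomialTerm x y p
    p·x≡0 : ∀ z → p · z ≡ 0#
    p·x≡0 z = begin
      p · z          ≡⟨ ×-congʳ p (*-identityˡ z) ⟨
      p · (1# * z)   ≡⟨ ×-assoc-* p 1# z ⟨
      (p · 1#) * z   ≡⟨ cong (_* z) p·1≡0 ⟩
      0# * z         ≡⟨ zeroˡ z ⟩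
      0#             ∎
    first : t zero ≡ y ^ p
    first = trans (×-homo-1 _) (trans (*-identityˡ _) (sym (^≡Exp y p)))
    last : t (fromℕ p) ≡ x ^ p
    last = begin
      (p C toℕ (fromℕ p)) · (x Exp.^ toℕ (fromℕ p) * y Exp.^ (p ℕ.∸ toℕ (fromℕ p)))
        ≡⟨ cong (λ k → (p C k) · (x Exp.^ k * y Exp.^ (p ℕ.∸ k))) (Fin.toℕ-fromℕ p) ⟩
      (p C p) · (x Exp.^ p * y Exp.^ (p ℕ.∸ p))
        ≡⟨ cong₂ (λ c k → c · (x Exp.^ p * y Exp.^ k)) (nCn≡1 p) (ℕ.n∸n≡0 p) ⟩
      1 · (x Exp.^ p * 1#)  ≡⟨ ×-homo-1 _ ⟩
      x Exp.^ p * 1#        ≡⟨ *-identityʳ _ ⟩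
      x Exp.^ p             ≡⟨ ^≡Exp x p ⟨
      x ^ p                 ∎
    -- The index lies strictly between 0 and `p`, so the binomial coefficient is a multiple of `p`.
    middle : ∀ k → t (suc (inject₁ k)) ≡ 0#
    middle k with prime∣binomial pp (s≤s z≤n) (s≤s (subst (ℕ._< p-1) (sym (Fin.toℕ-inject₁ k)) (Fin.toℕ<n k)))
    ... | divides d eq = trans (cong (_· Binomial.binomial x y p (suc (inject₁ k))) (trans eq (ℕ.*-comm d p))) (trans (sym (×-assocˡ _ p d)) (p·x≡0 _))

  -- The e-th power of `p · 1#` is `card · 1#`, which vanishes, and a field has no nonzero
  -- nilpotents.
  characteristic : ∀ {p} e → card ≡ p ℕ.^ e → p · 1# ≡ 0#
  characteristic {p} e card≡p^e = x^k≡0⇒x≡0 (p · 1#) e (trans (sym (power e)) (trans (cong (_· 1#) (sym card≡p^e)) (card·x≡0 1#)))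
    where
    power : ∀ e → (p ℕ.^ e) · 1# ≡ (p · 1#) ^ e
    power zero    = ×-homo-1 1#
    power (suc e) = trans (×1-homo-* p (p ℕ.^ e)) (cong (p · 1# *_) (power e))

  additive-^ : ∀ {p} → (∀ x y → (x + y) ^ p ≡ x ^ p + y ^ p) →
               ∀ e x y → (x + y) ^ (p ℕ.^ e) ≡ x ^ (p ℕ.^ e) + y ^ (p ℕ.^ e)
  additive-^ {p} add zero    x y = trans (*-identityʳ _) (sym (cong₂ _+_ (*-identityʳ x) (*-identityʳ y)))
  additive-^ {p} add (suc e) x y = begin
    (x + y) ^ (p ℕ.* p ℕ.^ e)                      ≡⟨ ^-*-assoc (x + y) p _ ⟨
    ((x + y) ^ p) ^ (p ℕ.^ e)                      ≡⟨ cong (_^ (p ℕ.^ e)) (add x y) ⟩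
    (x ^ p + y ^ p) ^ (p ℕ.^ e)                    ≡⟨ additive-^ add e (x ^ p) (y ^ p) ⟩
    (x ^ p) ^ (p ℕ.^ e) + (y ^ p) ^ (p ℕ.^ e)      ≡⟨ cong₂ _+_ (^-*-assoc x p _) (^-*-assoc y p _) ⟩
    x ^ (p ℕ.* p ℕ.^ e) + y ^ (p ℕ.* p ℕ.^ e)      ∎

  -- Frobenius twists and Dedekind's argument.

  module Frobenius (q n-1 : ℕ) (0<q : 0 ℕ.< q)
                   (additive : ∀ x y → (x + y) ^ q ≡ x ^ q + y ^ q)
                   (fermat : ∀ x → x ^ (q ℕ.^ suc n-1) ≡ x) where

    φ : ℕ → Carrier → Carrier
    φ d x = x ^ (q ℕ.^ d)

    φ-0 : ∀ d → φ d 0# ≡ 0#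
    φ-0 d = 0^k≡0 (ℕ.m^n>0 q {{ℕ.>-nonZero 0<q}} d)

    φ-zero : ∀ x → φ 0 x ≡ x
    φ-zero = *-identityʳ

    φ-suc : ∀ d x → φ 1 (φ d x) ≡ φ (suc d) x
    φ-suc d x = trans (^-*-assoc x (q ℕ.^ d) (q ℕ.^ 1))
      (cong (x ^_) (trans (cong (q ℕ.^ d ℕ.*_) (ℕ.*-identityʳ q)) (ℕ.*-comm (q ℕ.^ d) q)))

    φ1≡^q : ∀ x → φ 1 x ≡ x ^ q
    φ1≡^q x = cong (x ^_) (ℕ.*-identityʳ q)

    φ-fixed : ∀ {x} → InSubfield q x → ∀ d → φ d x ≡ x
    φ-fixed {x} fix zero    = φ-zero x
    φ-fixed {x} fix (suc d) = trans (sym (φ-suc d x)) (trans (cong (φ 1) (φ-fixed fix d)) (trans (φ1≡^q x) fix))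

    φ-⟨⟩ : ∀ d {s} (u v : Vec s) → φ d ⟨ u , v ⟩ ≡ ⟨ φ d ∘ u , φ d ∘ v ⟩
    φ-⟨⟩ d {zero}  u v = φ-0 d
    φ-⟨⟩ d {suc s} u v = trans (additive-^ additive d _ _)
      (cong₂ _+_ (^-distrib-* (u zero) (v zero) (q ℕ.^ d)) (φ-⟨⟩ d (u ∘ suc) (v ∘ suc)))

    -- The vectors y_(i,d) in K^s, one for each coordinate i and level d.
    conjugate : ∀ {m s} → (Fin s → Vec m) → Fin m → ℕ → Vec s
    conjugate x i d j = φ d (x j i)

    φ-conjugate : ∀ {m s} (x : Fin s → Vec m) w i d →
      φ 1 ⟨ w , conjugate x i d ⟩ ≡ ⟨ φ 1 ∘ w , conjugate x i (suc d) ⟩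
    φ-conjugate x w i d = trans (φ-⟨⟩ 1 w (conjugate x i d)) (⟨⟩-cong (λ _ → refl) (λ j → φ-suc d (x j i)))

    -- By `fermat`, `φ n-1` inverts `φ 1`. Pairing `w` with level d + 1 is thus the Frobenius image
    -- of pairing the untwisted `w` with level d, which is how twisting T_d acts on annihilators.
    untwist : ∀ {m s} (x : Fin s → Vec m) w i d →
      ⟨ w , conjugate x i (suc d) ⟩ ≡ φ 1 ⟨ φ n-1 ∘ w , conjugate x i d ⟩
    untwist x w i d = sym (trans (φ-conjugate x (φ n-1 ∘ w) i d)
      (⟨⟩-cong (λ j → trans (φ-suc n-1 (w j)) (fermat (w j))) (λ _ → refl)))

    LinIndepOver-tail : ∀ {m s} (x : Fin (suc s) → Vec m) → LinIndepOver q x → LinIndepOver q (x ∘ suc)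
    LinIndepOver-tail x indep c c∈𝔽q rel j = indep c⁺ c⁺∈𝔽q rel⁺ (suc j)
      where
      c⁺ : Vec _
      c⁺ zero    = 0#
      c⁺ (suc j) = c j
      c⁺∈𝔽q : ∀ j → InSubfield q (c⁺ j)
      c⁺∈𝔽q zero    = 0^k≡0 0<q
      c⁺∈𝔽q (suc j) = c∈𝔽q j
      rel⁺ : lincomb c⁺ x ≋ (λ _ → 0#)
      rel⁺ i = trans (cong₂ _+_ (zeroˡ (x zero i)) (rel i)) (+-identityˡ 0#)

    -- Dedekind's argument: a relation with leading coefficient 1 minus its Frobenius twist is
    -- a shorter relation, so the coefficients of the relation lie in the subfield.
    conjugates-span : ∀ {m s} (x : Fin s → Vec m) → LinIndepOver q x →
      (c : Vec s) → (∀ i d → d ℕ.< suc n-1 → ⟨ c , conjugate x i d ⟩ ≡ 0#) → ∀ j → c j ≡ 0#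
    conjugates-span {s = zero}  x indep c c⊥x ()
    conjugates-span {s = suc s} x indep c c⊥x with c zero ≟ 0#
    ... | yes c₀≡0 = λ where
        zero    → c₀≡0
        (suc j) → conjugates-span (x ∘ suc) (LinIndepOver-tail x indep) (c ∘ suc) tail⊥ j
      where
      tail⊥ : ∀ i d → d ℕ.< suc n-1 → ⟨ c ∘ suc , conjugate (x ∘ suc) i d ⟩ ≡ 0#
      tail⊥ i d d<n = begin
        ⟨ c ∘ suc , conjugate (x ∘ suc) i d ⟩                                 ≡⟨ +-identityˡ _ ⟨
        0# + ⟨ c ∘ suc , conjugate (x ∘ suc) i d ⟩
          ≡⟨ cong (_+ ⟨ c ∘ suc , conjugate (x ∘ suc) i d ⟩) (trans (cong (_* φ d (x zero i)) c₀≡0) (zeroˡ _)) ⟨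
        ⟨ c , conjugate x i d ⟩                                               ≡⟨ c⊥x i d d<n ⟩
        0#                                                                    ∎
    ... | no c₀≢0 with inverse (c zero) c₀≢0
    ...   | u , c₀u≡1 = contradiction (trans (sym (e≡0 zero)) e₀≡1) 0≢1
      where
      e δ : Vec (suc s)
      e j = u * c j
      δ j = φ 1 (e j) + - e j
      e₀≡1 : e zero ≡ 1#
      e₀≡1 = trans (*-comm u (c zero)) c₀u≡1
      e⊥x : ∀ i d → d ℕ.< suc n-1 → ⟨ e , conjugate x i d ⟩ ≡ 0#
      e⊥x i d d<n = trans (⟨⟩-*ˡ u c (conjugate x i d)) (trans (cong (u *_) (c⊥x i d d<n)) (zeroʳ u))
      φe⊥x : ∀ i d → d ℕ.< suc n-1 → ⟨ φ 1 ∘ e , conjugate x i d ⟩ ≡ 0#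
      -- Level 0 equals level n by `fermat`, so the relation at level n - 1 twists round to level 0
      -- and the range of levels is closed under twisting.
      φe⊥x i zero    _   = begin
        ⟨ φ 1 ∘ e , conjugate x i 0 ⟩
          ≡⟨ ⟨⟩-cong {u = φ 1 ∘ e} (λ _ → refl) (λ j → trans (φ-zero (x j i)) (sym (fermat (x j i)))) ⟩
        ⟨ φ 1 ∘ e , conjugate x i (suc n-1) ⟩  ≡⟨ φ-conjugate x e i n-1 ⟨
        φ 1 ⟨ e , conjugate x i n-1 ⟩          ≡⟨ cong (φ 1) (e⊥x i n-1 (ℕ.n<1+n n-1)) ⟩
        φ 1 0#                                 ≡⟨ φ-0 1 ⟩
        0#                                     ∎
      φe⊥x i (suc d) d<n = trans (sym (φ-conjugate x e i d))
        (trans (cong (φ 1) (e⊥x i d (ℕ.<-trans (ℕ.n<1+n d) d<n))) (φ-0 1))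
      δ₀≡0 : δ zero ≡ 0#
      δ₀≡0 = trans (cong (_+ - e zero) (trans (cong (φ 1) e₀≡1) (trans (1^k≡1 (q ℕ.^ 1)) (sym e₀≡1)))) (-‿inverseʳ (e zero))
        where
        1^k≡1 : ∀ k → 1# ^ k ≡ 1#
        1^k≡1 zero    = refl
        1^k≡1 (suc k) = trans (*-identityˡ _) (1^k≡1 k)
      tail⊥ : ∀ i d → d ℕ.< suc n-1 → ⟨ δ ∘ suc , conjugate (x ∘ suc) i d ⟩ ≡ 0#
      tail⊥ i d d<n = begin
        ⟨ δ ∘ suc , conjugate (x ∘ suc) i d ⟩                                 ≡⟨ +-identityˡ _ ⟨
        0# + ⟨ δ ∘ suc , conjugate (x ∘ suc) i d ⟩
          ≡⟨ cong (_+ ⟨ δ ∘ suc , conjugate (x ∘ suc) i d ⟩) (trans (cong (_* φ d (x zero i)) δ₀≡0) (zeroˡ _)) ⟨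
        ⟨ δ , conjugate x i d ⟩
          ≡⟨ ⟨⟩--ˡ (φ 1 ∘ e) e (conjugate x i d) ⟩
        ⟨ φ 1 ∘ e , conjugate x i d ⟩ + - ⟨ e , conjugate x i d ⟩
          ≡⟨ cong₂ (λ a b → a + - b) (φe⊥x i d d<n) (e⊥x i d d<n) ⟩
        0# + - 0#                                                             ≡⟨ -‿inverseʳ 0# ⟩
        0#                                                                    ∎
      δ≡0 : ∀ j → δ j ≡ 0#
      δ≡0 zero    = δ₀≡0
      δ≡0 (suc j) = conjugates-span (x ∘ suc) (LinIndepOver-tail x indep) (δ ∘ suc) tail⊥ j
      e≡0 : ∀ j → e j ≡ 0#
      -- Since `δ` vanishes, the entries of `e` lie in the subfield, and the level-0 relation
      -- becomes one to which independence applies.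
      e≡0 = indep e (λ j → trans (sym (φ1≡^q (e j))) (x∙y⁻¹≈ε⇒x≈y _ _ (δ≡0 j)))
        (λ i → trans (⟨⟩-cong {u = e} (λ _ → refl) (λ j → sym (φ-zero (x j i)))) (e⊥x i 0 (s≤s z≤n)))

    -- Annihilators of the spaces T_d, pivot indices and the dimension bound.

    module _ {m s : ℕ} (x : Fin s → Vec m) (J : ℕ) where

      -- The annihilator of T_(D-1). Quantifying over `Fin D` makes it decidable by finite search.
      OrthogonalBelow : ℕ → Vec s → Set
      OrthogonalBelow D w = ∀ i (d : Fin D) → ⟨ w , conjugate x i (toℕ d) ⟩ ≡ 0#

      orthogonalBelow : ∀ {D w} → OrthogonalBelow D w → ∀ i {d} → d ℕ.< D → ⟨ w , conjugate x i d ⟩ ≡ 0#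
      orthogonalBelow {w = w} ⊥w i d<D =
        subst (λ d → ⟨ w , conjugate x i d ⟩ ≡ 0#) (Fin.toℕ-fromℕ< d<D) (⊥w i (fromℕ< d<D))

      private
        -- The index set A: the greedy choice on the annihilator of T_(J-1) yields indices whose
        -- level-J vectors form a basis of T_J modulo T_(J-1).
        pivots : _
        pivots = selectBasis {W = OrthogonalBelow J}
          (λ u≋v ⊥u i d → trans (⟨⟩-cong (λ j → sym (u≋v j)) (λ _ → refl)) (⊥u i d))
          (λ w → Fin.all? (λ i → Fin.all? (λ d → ⟨ w , conjugate x i (toℕ d) ⟩ ≟ 0#)))
          (λ i w → ⟨ w , conjugate x i J ⟩) (λ i u≋v → ⟨⟩-cong u≋v (λ _ → refl))

      pivotCount : ℕ
      pivotCount = proj₁ pivots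

      pivot : Fin pivotCount → Fin m
      pivot = proj₁ (proj₂ pivots)

      -- By duality, a vector killed by the annihilator of T_(J-1) lies in T_(J-1), so this is
      -- independence modulo T_(J-1).
      pivot-independent : ∀ (c : Vec pivotCount) →
        (∀ w → OrthogonalBelow J w → ⟨ c , (λ p → ⟨ w , conjugate x (pivot p) J ⟩) ⟩ ≡ 0#) → ∀ p → c p ≡ 0#
      pivot-independent = proj₁ (proj₂ (proj₂ pivots))

      -- Untwisting `w` lowers every level by one, so orthogonality below `suc t + J` becomes
      -- orthogonality below `t + J`, with level 0 discarded. The pivots chosen at level `J` thus
      -- serve at every higher level.
      pivot-spanning : ∀ t w → OrthogonalBelow (t ℕ.+ J) w →
        (∀ p → ⟨ w , conjugate x (pivot p) (t ℕ.+ J) ⟩ ≡ 0#) → ∀ i → ⟨ w , conjugate x i (t ℕ.+ J) ⟩ ≡ 0#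
      pivot-spanning zero    = proj₂ (proj₂ (proj₂ pivots))
      pivot-spanning (suc t) w ⊥w ⊥pivots i = trans (untwist x w i (t ℕ.+ J)) (trans (cong (φ 1)
        (pivot-spanning t (φ n-1 ∘ w)
          (λ i d → twist-injective i (toℕ d) (⊥w i (suc d)))
          (λ p → twist-injective (pivot p) (t ℕ.+ J) (⊥pivots p)) i)) (φ-0 1))
        where
        twist-injective : ∀ i d → ⟨ w , conjugate x i (suc d) ⟩ ≡ 0# → ⟨ φ n-1 ∘ w , conjugate x i d ⟩ ≡ 0#
        twist-injective i d eq = x^k≡0⇒x≡0 _ (q ℕ.^ 1) (trans (sym (untwist x w i d)) eq)

      -- Climbs the levels one at a time: below `J` the assumption on `w` suffices, and from `J` on
      -- each level follows from the earlier ones by `pivot-spanning` with t = d - J.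
      orthogonalBelow-pivots : ∀ n w → OrthogonalBelow J w →
        (∀ p (d : Fin n) → ⟨ w , conjugate x (pivot p) (toℕ d) ⟩ ≡ 0#) →
        ∀ i d → d ℕ.< n → ⟨ w , conjugate x i d ⟩ ≡ 0#
      orthogonalBelow-pivots n w ⊥w ⊥pivots i d d<n = below n ℕ.≤-refl i d d<n
        where
        below : ∀ D → D ℕ.≤ n → ∀ i d → d ℕ.< D → ⟨ w , conjugate x i d ⟩ ≡ 0#
        below (suc D) D<n i d (s≤s d≤D) with ℕ.m≤n⇒m<n∨m≡n d≤D
        ... | inj₁ d<D = below D (ℕ.<⇒≤ D<n) i d d<D
        ... | inj₂ refl with d ℕ.<? J
        ...   | yes d<J = orthogonalBelow ⊥w i d<J
        ...   | no  d≮J = subst (λ e → ⟨ w , conjugate x i e ⟩ ≡ 0#) t+J≡d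
                  (pivot-spanning (d ℕ.∸ J) w
                    (λ i e → below d (ℕ.<⇒≤ D<n) i (toℕ e) (subst (toℕ e ℕ.<_) t+J≡d (Fin.toℕ<n e)))
                    (λ p → subst (λ e → ⟨ w , conjugate x (pivot p) e ⟩ ≡ 0#) (trans (Fin.toℕ-fromℕ< D<n) (sym t+J≡d))
                      (⊥pivots p (fromℕ< D<n)))
                    i)
          where
          t+J≡d : (d ℕ.∸ J) ℕ.+ J ≡ d
          t+J≡d = ℕ.m∸n+n≡m (ℕ.≮⇒≥ d≮J)

      -- Were `s` larger, some nonzero `c` would annihilate T_(J-1) and all conjugates of the
      -- pivots, hence every conjugate below level n, against `conjugates-span`.
      dimension≤ : LinIndepOver q x → s ℕ.≤ m ℕ.* J ℕ.+ pivotCount ℕ.* suc n-1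
      dimension≤ indep with s ℕ.≤? m ℕ.* J ℕ.+ pivotCount ℕ.* suc n-1
      ... | yes s≤ = s≤
      ... | no  s≰ = contradiction
        (conjugates-span x indep c (orthogonalBelow-pivots (suc n-1) c ⊥low ⊥pivots)) c≢0
        where
        -- The first `m * J` vectors span T_(J-1); the others are the n conjugates of each pivot.
        generator : Fin (m ℕ.* J) ⊎ Fin (pivotCount ℕ.* suc n-1) → Vec s
        generator (inj₁ z) = conjugate x (proj₁ (remQuot J z)) (toℕ (proj₂ (remQuot {m} J z)))
        generator (inj₂ z) = conjugate x (pivot (proj₁ (remQuot (suc n-1) z))) (toℕ (proj₂ (remQuot {pivotCount} (suc n-1) z)))
        kernel : _
        kernel = nontrivialKernel (ℕ.≰⇒> s≰) (λ z → generator (splitAt (m ℕ.* J) z))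
        c : Vec s
        c = proj₁ kernel
        c≢0 : ¬ (∀ j → c j ≡ 0#)
        c≢0 = proj₁ (proj₂ kernel)
        ⊥low : OrthogonalBelow J c
        ⊥low i d = subst (λ (i , d) → ⟨ c , conjugate x i (toℕ d) ⟩ ≡ 0#) (Fin.remQuot-combine i d)
          (subst (λ z → ⟨ c , generator z ⟩ ≡ 0#) (Fin.splitAt-↑ˡ (m ℕ.* J) (combine i d) _)
            (proj₂ (proj₂ kernel) (combine i d ↑ˡ _)))
        ⊥pivots : ∀ p (d : Fin (suc n-1)) → ⟨ c , conjugate x (pivot p) (toℕ d) ⟩ ≡ 0#
        ⊥pivots p d = subst (λ (p , d) → ⟨ c , conjugate x (pivot p) (toℕ d) ⟩ ≡ 0#) (Fin.remQuot-combine p d)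
          (subst (λ z → ⟨ c , generator z ⟩ ≡ 0#) (Fin.splitAt-↑ʳ (m ℕ.* J) _ (combine p d))
            (proj₂ (proj₂ kernel) (m ℕ.* J ↑ʳ combine p d)))

    -- Coordinate forms of `U` on the subspace `H`.

    module _ {m s : ℕ} (I J : ℕ) (α : Vec m) (x : Fin s → Vec m) (v : Fin s → Vec (m ℕ.+ m))
             (v≋ : ∀ j → v j ≋ (x j ++ fA F q I J α (x j))) where

      v-↑ˡ : ∀ j i → v j (i ↑ˡ m) ≡ x j i
      v-↑ˡ j i = trans (v≋ j (i ↑ˡ m)) (cong [ x j , fA F q I J α (x j) ] (Fin.splitAt-↑ˡ m i m))

      v-↑ʳ : ∀ j i → v j (m ↑ʳ i) ≡ φ I (x j i) + α (next i) * φ J (x j (next i))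
      v-↑ʳ j i = trans (v≋ j (m ↑ʳ i)) (cong [ x j , fA F q I J α (x j) ] (Fin.splitAt-↑ʳ m m i))

      ⟨⟩-v-↑ʳ : ∀ (w : Vec s) i → ⟨ w , (λ j → v j (m ↑ʳ i)) ⟩ ≡
                ⟨ w , conjugate x i I ⟩ + α (next i) * ⟨ w , conjugate x (next i) J ⟩
      ⟨⟩-v-↑ʳ w i = begin
        ⟨ w , (λ j → v j (m ↑ʳ i)) ⟩
          ≡⟨ ⟨⟩-cong {u = w} (λ _ → refl) (λ j → v-↑ʳ j i) ⟩
        ⟨ w , (λ j → φ I (x j i) + α (next i) * φ J (x j (next i))) ⟩
          ≡⟨ ⟨⟩-+ʳ w (conjugate x i I) (λ j → α (next i) * φ J (x j (next i))) ⟩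
        ⟨ w , conjugate x i I ⟩ + ⟨ w , (λ j → α (next i) * φ J (x j (next i))) ⟩
          ≡⟨ cong (⟨ w , conjugate x i I ⟩ +_) (⟨⟩-*ʳ (α (next i)) w (conjugate x (next i) J)) ⟩
        ⟨ w , conjugate x i I ⟩ + α (next i) * ⟨ w , conjugate x (next i) J ⟩ ∎

      -- Subfield coefficients are fixed by every `φ d`, so a relation among the `x j` persists
      -- among their conjugates and hence in the last `m` coordinates of the `v j`.
      LinIndepOver-projection : LinIndepOver q v → LinIndepOver q x
      LinIndepOver-projection indep c c∈𝔽q rel = indep c c∈𝔽q rel⁺
        where
        conjugate-rel : ∀ i d → ⟨ c , conjugate x i d ⟩ ≡ 0#
        conjugate-rel i d = begin
          ⟨ c , conjugate x i d ⟩
            ≡⟨ ⟨⟩-cong {v = conjugate x i d} (λ j → φ-fixed (c∈𝔽q j) d) (λ _ → refl) ⟨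
          ⟨ φ d ∘ c , conjugate x i d ⟩    ≡⟨ φ-⟨⟩ d c (λ j → x j i) ⟨
          φ d ⟨ c , (λ j → x j i) ⟩        ≡⟨ cong (φ d) (rel i) ⟩
          φ d 0#                           ≡⟨ φ-0 d ⟩
          0#                               ∎
        at : ∀ (z : Fin m ⊎ Fin m) → lincomb c v (join m m z) ≡ 0#
        at (inj₁ i) = trans (⟨⟩-cong {u = c} (λ _ → refl) (λ j → v-↑ˡ j i)) (rel i)
        at (inj₂ i) = trans (⟨⟩-v-↑ʳ c i) (trans
          (cong₂ (λ a b → a + α (next i) * b) (conjugate-rel i I) (conjugate-rel (next i) J))
          (trans (+-identityˡ _) (zeroʳ (α (next i)))))
        rel⁺ : lincomb c v ≋ (λ _ → 0#)
        rel⁺ z = subst (λ z → lincomb c v z ≡ 0#) (Fin.join-splitAt m m z) (at (splitAt m z))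

      -- A coordinate form on `H` is determined by its values on `b`, so more than `r` forms satisfy
      -- a nontrivial relation. For the x- and f-coordinates attached to the pivots, such a relation
      -- is shown to vanish, first in its f-part `c₂` and then in its x-part `c₁`.
      2*pivotCount≤ : I ℕ.< J → (∀ i → α i ≢ 0#) → ∀ {r} (b : Fin r → Vec (m ℕ.+ m)) →
        (∀ j → InSpan b (v j)) → pivotCount x J ℕ.+ pivotCount x J ℕ.≤ r
      2*pivotCount≤ I<J α≢0 {r} b v∈H with pivotCount x J ℕ.+ pivotCount x J ℕ.≤? r
      ... | yes 2a≤r = 2a≤r
      ... | no  2a≰r = contradiction c≡0 c≢0
        where
        a : ℕ
        a = pivotCount x J
        A prev : Fin a → Fin m
        A = pivot x J
        -- Chosen so that the q^J-term of the f-coordinate at `prev p` involves the pivot `A p`.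
        prev p = proj₁ (next-surjective (A p))
        next-prev : ∀ p → next (prev p) ≡ A p
        next-prev p = proj₂ (next-surjective (A p))
        form : Fin a ⊎ Fin a → Fin (m ℕ.+ m)
        form = [ (λ p → A p ↑ˡ m) , (λ p → m ↑ʳ prev p) ]
        position : Fin (a ℕ.+ a) → Fin (m ℕ.+ m)
        position z = form (splitAt a z)
        kernel : _
        kernel = nontrivialKernel (ℕ.≰⇒> 2a≰r) (λ l z → b l (position z))
        c : Vec (a ℕ.+ a)
        c = proj₁ kernel
        c≢0 : ¬ (∀ z → c z ≡ 0#)
        c≢0 = proj₁ (proj₂ kernel)
        c₁ c₂ : Vec a
        c₁ p = c (p ↑ˡ a)
        c₂ p = c (a ↑ʳ p)
        c⊥v : ∀ j → ⟨ c , (λ z → v j (position z)) ⟩ ≡ 0#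
        c⊥v j = begin
          ⟨ c , (λ z → v j (position z)) ⟩
            ≡⟨ ⟨⟩-cong {u = c} (λ _ → refl) (λ z → proj₂ (v∈H j) (position z)) ⟩
          ⟨ c , (λ z → ⟨ proj₁ (v∈H j) , (λ l → b l (position z)) ⟩) ⟩
            ≡⟨ ⟨⟩-swap c (proj₁ (v∈H j)) (λ z l → b l (position z)) ⟩
          ⟨ proj₁ (v∈H j) , (λ l → ⟨ c , (λ z → b l (position z)) ⟩) ⟩
            ≡⟨ ⟨⟩-zeroʳ (proj₁ (v∈H j)) (proj₂ (proj₂ kernel)) ⟩
          0# ∎
        c-split : ∀ (u : Fin (m ℕ.+ m) → Carrier) → ⟨ c , (λ z → u (position z)) ⟩ ≡
                  ⟨ c₁ , (λ p → u (A p ↑ˡ m)) ⟩ + ⟨ c₂ , (λ p → u (m ↑ʳ prev p)) ⟩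
        c-split u = trans (Σ-↑ a a (λ z → c z * u (position z))) (cong₂ _+_
          (⟨⟩-cong {u = c₁} (λ _ → refl) (λ p → cong (u ∘ form) (Fin.splitAt-↑ˡ a p a)))
          (⟨⟩-cong {u = c₂} (λ _ → refl) (λ p → cong (u ∘ form) (Fin.splitAt-↑ʳ a a p))))
        -- Pair the relation with any `w` annihilating T_(J-1): the x-part has level 0 and the first
        -- terms of the f-part have level I, both below `J`, so only the level-J pivot terms scaled
        -- by `α` survive.
        c₂α≡0 : ∀ p → c₂ p * α (A p) ≡ 0#
        c₂α≡0 = pivot-independent x J (λ p → c₂ p * α (A p)) λ w ⊥w → begin
          ⟨ (λ p → c₂ p * α (A p)) , (λ p → ⟨ w , conjugate x (A p) J ⟩) ⟩
            ≡⟨ Σ-cong (λ p → trans (*-assoc (c₂ p) _ _) (cong (c₂ p *_) (sym (upper w ⊥w p)))) ⟩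
          ⟨ c₂ , (λ p → ⟨ w , (λ j → v j (m ↑ʳ prev p)) ⟩) ⟩
            ≡⟨ +-identityˡ _ ⟨
          0# + ⟨ c₂ , (λ p → ⟨ w , (λ j → v j (m ↑ʳ prev p)) ⟩) ⟩
            ≡⟨ cong (_+ ⟨ c₂ , (λ p → ⟨ w , (λ j → v j (m ↑ʳ prev p)) ⟩) ⟩) (⟨⟩-zeroʳ c₁ (lower w ⊥w)) ⟨
          ⟨ c₁ , (λ p → ⟨ w , (λ j → v j (A p ↑ˡ m)) ⟩) ⟩ + ⟨ c₂ , (λ p → ⟨ w , (λ j → v j (m ↑ʳ prev p)) ⟩) ⟩
            ≡⟨ c-split (λ i → ⟨ w , (λ j → v j i) ⟩) ⟨
          ⟨ c , (λ z → ⟨ w , (λ j → v j (position z)) ⟩) ⟩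
            ≡⟨ ⟨⟩-swap c w (λ z j → v j (position z)) ⟩
          ⟨ w , (λ j → ⟨ c , (λ z → v j (position z)) ⟩) ⟩
            ≡⟨ ⟨⟩-zeroʳ w c⊥v ⟩
          0# ∎
          where
          lower : ∀ w → OrthogonalBelow x J J w → ∀ p → ⟨ w , (λ j → v j (A p ↑ˡ m)) ⟩ ≡ 0#
          lower w ⊥w p = trans (⟨⟩-cong {u = w} (λ _ → refl) (λ j → trans (v-↑ˡ j (A p)) (sym (φ-zero (x j (A p))))))
            (orthogonalBelow x J ⊥w (A p) (ℕ.≤-<-trans z≤n I<J))
          upper : ∀ w → OrthogonalBelow x J J w → ∀ p →
            ⟨ w , (λ j → v j (m ↑ʳ prev p)) ⟩ ≡ α (A p) * ⟨ w , conjugate x (A p) J ⟩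
          upper w ⊥w p = begin
            ⟨ w , (λ j → v j (m ↑ʳ prev p)) ⟩
              ≡⟨ ⟨⟩-v-↑ʳ w (prev p) ⟩
            ⟨ w , conjugate x (prev p) I ⟩ + α (next (prev p)) * ⟨ w , conjugate x (next (prev p)) J ⟩
              ≡⟨ cong₂ (λ z i → z + α i * ⟨ w , conjugate x i J ⟩) (orthogonalBelow x J ⊥w (prev p) I<J) (next-prev p) ⟩
            0# + α (A p) * ⟨ w , conjugate x (A p) J ⟩
              ≡⟨ +-identityˡ _ ⟩
            α (A p) * ⟨ w , conjugate x (A p) J ⟩ ∎
        c₂≡0 : ∀ p → c₂ p ≡ 0#
        c₂≡0 p = x*y≡0⇒y≡0 (α≢0 (A p)) (trans (*-comm _ _) (c₂α≡0 p))
        c₁⊥x : ∀ j → ⟨ c₁ , (λ p → x j (A p)) ⟩ ≡ 0#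
        c₁⊥x j = begin
          ⟨ c₁ , (λ p → x j (A p)) ⟩
            ≡⟨ ⟨⟩-cong {u = c₁} (λ _ → refl) (λ p → v-↑ˡ j (A p)) ⟨
          ⟨ c₁ , (λ p → v j (A p ↑ˡ m)) ⟩
            ≡⟨ +-identityʳ _ ⟨
          ⟨ c₁ , (λ p → v j (A p ↑ˡ m)) ⟩ + 0#
            ≡⟨ cong (⟨ c₁ , (λ p → v j (A p ↑ˡ m)) ⟩ +_) (Σ-zero (λ p → trans (cong (_* v j (m ↑ʳ prev p)) (c₂≡0 p)) (zeroˡ _))) ⟨
          ⟨ c₁ , (λ p → v j (A p ↑ˡ m)) ⟩ + ⟨ c₂ , (λ p → v j (m ↑ʳ prev p)) ⟩
            ≡⟨ c-split (v j) ⟨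
          ⟨ c , (λ z → v j (position z)) ⟩
            ≡⟨ c⊥v j ⟩
          0# ∎
        -- Raising the level-0 relation to the power q^J gives one among the level-J pivot vectors.
        φc₁≡0 : ∀ p → φ J (c₁ p) ≡ 0#
        φc₁≡0 = pivot-independent x J (φ J ∘ c₁) λ w _ →
          trans (⟨⟩-swap (φ J ∘ c₁) w (λ p → conjugate x (A p) J))
            (⟨⟩-zeroʳ w (λ j → trans (sym (φ-⟨⟩ J c₁ (λ p → x j (A p)))) (trans (cong (φ J) (c₁⊥x j)) (φ-0 J))))
        c≡0-at : ∀ z → c (join a a z) ≡ 0#
        c≡0-at (inj₁ p) = x^k≡0⇒x≡0 (c₁ p) (q ℕ.^ J) (φc₁≡0 p)
        c≡0-at (inj₂ p) = c₂≡0 p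
        c≡0 : ∀ z → c z ≡ 0#
        c≡0 z = subst (λ z → c z ≡ 0#) (Fin.join-splitAt a a z) (c≡0-at (splitAt a z))

-- Numerical estimate and conclusion.

open import Data.Nat using (ℕ; _+_; _*_; _^_; _≤_; _<_)

-- The target is s ≤ rn/2 - 1 with the denominator cleared. For r = 2k + 1 the bound on `a` gives a
-- ≤ k, and the assumption on `n` absorbs 2mJ + 2 into the one remaining n.
evasive-bound : ∀ {s a r m n J} → s ≤ m * J + a * n → a + a ≤ r → Odd r → 2 * (m * J + J + 1) ≤ n →
                2 * s + 2 ≤ r * n
evasive-bound {s} {a} {r} {m} {n} {J} s≤ 2a≤r (k , refl) n≥ = begin
  2 * s + 2
    ≤⟨ ℕ.+-monoˡ-≤ 2 (ℕ.*-monoʳ-≤ 2 (ℕ.≤-trans s≤ (ℕ.+-monoʳ-≤ (m * J) (ℕ.*-monoˡ-≤ n a≤k)))) ⟩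
  -- Adding 2J completes 2mJ + 2 to the left side of the assumption on `n`.
  2 * (m * J + k * n) + 2          ≤⟨ ℕ.m≤m+n _ (2 * J) ⟩
  2 * (m * J + k * n) + 2 + 2 * J
    ≡⟨ solve 4 (λ m J k n → con 2 :* (m :* J :+ k :* n) :+ con 2 :+ con 2 :* J := con 2 :* (m :* J :+ J :+ con 1) :+ con 2 :* k :* n) refl m J k n ⟩
  2 * (m * J + J + 1) + 2 * k * n  ≤⟨ ℕ.+-monoˡ-≤ (2 * k * n) n≥ ⟩
  n + 2 * k * n                    ∎
  where
  open ℕ.≤-Reasoning
  open +-*-Solver
  a≤k : a ≤ k
  -- Oddness enters here: k < a would give 2a ≥ 2k + 2, which exceeds r.
  a≤k = ℕ.≮⇒≥ λ k<a → ℕ.<⇒≱ (ℕ.+-mono-≤-< k<a k<a)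
    (ℕ.≤-trans 2a≤r (ℕ.≤-reflexive (cong (λ t → suc (k + t)) (ℕ.+-identityʳ k))))

mainTheorem4 : (q n m I J : ℕ) → IsPrimePower q → 1 ≤ n → 3 ≤ m → I < J → J < n →
    (F : FiniteField) → FiniteField.card F ≡ q ^ n →
    (α : Fin m → FiniteField.Carrier F) → (∀ i → α i ≢ FiniteField.0# F) →
    2 * (m * J + J + 1) ≤ n →
    (r : ℕ) → Odd r → 2 ≤ r → r ≤ m →
    FiniteField.EvasiveWith F q (U-IJ F q I J α) r (λ s → 2 * s + 2 ≤ r * n)
mainTheorem4 q (suc n-1) m I J (p , e , p-prime , _ , refl) _ _ I<J _ F card≡q^n α α≢0 n≥ r odd _ _
             b _ s v v∈U v∈H v-indep =
  evasive-bound {s} {pivotCount x J} {m = m} {J = J}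
    (dimension≤ x J (LinIndepOver-projection I J α x v v≋ v-indep))
    (2*pivotCount≤ I J α x v v≋ I<J α≢0 b v∈H) odd n≥
  where
  open FiniteField F using (Vec)
  open FiniteFieldProperties F
  n : ℕ
  n = suc n-1
  char : _
  -- As q = p^e, the number of elements q^n is the power of `p` with exponent `e * n`.
  char = characteristic {p} (e * n) (trans card≡q^n (ℕ.^-*-assoc p e n))
  open Frobenius q n-1 (ℕ.m^n>0 p {{prime⇒nonZero p-prime}} e)
    (additive-^ (freshman p-prime char) e)
    (λ y → trans (cong (FiniteField._^_ F y) (sym card≡q^n)) (x^card≡x y))
  x : Fin s → Vec m
  x j = proj₁ (v∈U j)
  v≋ : ∀ j i → v j i ≡ (x j ++ fA F q I J α (x j)) i
  v≋ j = proj₂ (v∈U j)
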